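{- Let $G$ be a finite, simple, connected graph. Then $res_{wt}(G)=3$ if and only if $G$ is a cycle of odd order or $G$ is a path of order at least three.
   Context: $d(x,y)$ is the shortest-path distance. A set $W\subseteq V(G)$ is a resolving set if for every two distinct vertices $y,z$ there is $x\in W$ with $d(y,x)\ne d(z,x)$. A set $W$ is a weak total resolving set (WTR-set) if $W$ is resolving and, for every $w\in W$ and every $x\in V(G)\setminus W$, there is $w'\in W\setminus\{w\}$ with $d(x,w')\ne d(w,w')$. The weak total resolving number $res_{wt}(G)$ is the minimum positive integer $r$ such that every set of $r$ vertices of $G$ is a WTR-set for $G$. -}

module Defs where

open import Data.Empty using (⊥-elim)
open import Data.Fin using (Fin; toℕ)
open import Data.Fin.Properties using (any?; all?) renaming (_≟_ to _≟ᶠ_)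
open import Data.Fin.Subset using (Subset; _∈_; _∉_; ∣_∣)
open import Data.Fin.Subset.Properties using (_∈?_; anySubset?; ∣p∣≤n)
open import Data.Nat using (ℕ; zero; suc; _≤_; _≤?_; z≤n; s≤s; _≟_)
open import Data.Nat.Divisibility using (_∤_)
open import Data.Nat.Properties using (1+n≰n; 1+n≢n)
open import Data.Product using (Σ; _×_; _,_; ∃; proj₁; uncurry)
open import Data.Sum using (_⊎_; inj₁; inj₂; [_,_])
import Data.Sum as Sum
open import Function using (_∘_; _↔_; _⇔_; Inverse)
open import Relation.Binary using (Rel; Symmetric)
  renaming (Decidable to Decidable₂)
open import Relation.Binary.PropositionalEquality
  using (_≡_; _≢_; refl; sym; trans; cong; subst)
open import Relation.Nullary using (¬_; Dec; yes; no)
open import Relation.Nullary.Decidable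
  using (map′; ¬?; _×-dec_; _⊎-dec_; _→-dec_; decidable-stable)
open import Relation.Unary using (Pred; Decidable)
open import Level using (0ℓ)

-- Decidability of adjacency is what makes a finite graph a finite object
-- constructively.

record Graph (n : ℕ) : Set₁ where
  field
    Adj     : Rel (Fin n) 0ℓ
    adj?    : Decidable₂ Adj
    adj-sym : Symmetric Adj
    irrefl  : ∀ u → ¬ Adj u u

record _≅_ {m n : ℕ} (G : Graph m) (H : Graph n) : Set where
  field
    bijection : Fin m ↔ Fin n
  open Inverse bijection public using (to; from)
  field
    adj⇔ : ∀ u v → Graph.Adj G u v ⇔ Graph.Adj H (to u) (to v)

infix 4 _≅_

Least : Pred ℕ 0ℓ → Pred ℕ 0ℓ
Least P k = P k × (∀ j → P j → k ≤ j)

least : ∀ {P : Pred ℕ 0ℓ} → Decidable P → ∀ k → P k → ∃ (Least P)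
least P? zero p = zero , p , λ _ _ → z≤n
least {P} P? (suc k) p with P? zero
... | yes p₀ = zero , p₀ , λ _ _ → z≤n
... | no ¬p₀ with least (P? ∘ suc) k p
...   | m , pm , min = suc m , pm , minimal
  where
  minimal : ∀ j → P j → suc m ≤ j
  minimal zero    p₀ = ⊥-elim (¬p₀ p₀)
  minimal (suc j) pj = s≤s (min j pj)

allSubset? : ∀ {n} {P : Pred (Subset n) 0ℓ} →
             Decidable P → Dec (∀ W → P W)
allSubset? P? = map′
  (λ ¬∃ W → decidable-stable (P? W) (λ ¬p → ¬∃ (W , ¬p)))
  (λ ∀p (W , ¬p) → ¬p (∀p W))
  (¬? (anySubset? (¬? ∘ P?)))

module _ {n : ℕ} (G : Graph n) where
  open Graph G

  data Walk : Fin n → Fin n → ℕ → Set where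
    []  : ∀ {u} → Walk u u 0
    _∷_ : ∀ {u v w k} → Adj u v → Walk v w k → Walk u w (suc k)

  -- The graph with no vertices is not excluded here; its weak total
  -- resolving number below is 1, and it is neither a cycle nor a path of
  -- order at least three.
  Connected : Set
  Connected = ∀ u v → ∃ (Walk u v)

  walk? : ∀ u v → Decidable (Walk u v)
  walk? u v zero with u ≟ᶠ v
  ... | yes refl = yes []
  ... | no  u≢v  = no λ { [] → u≢v refl }
  walk? u v (suc k) = map′
    (λ (_ , a , p) → a ∷ p)
    (λ { (a ∷ p) → _ , a , p })
    (any? (λ w → adj? u w ×-dec walk? w v k))

  module _ (connected : Connected) where

    shortest : ∀ u v → ∃ (Least (Walk u v))
    shortest u v = uncurry (least (walk? u v)) (connected u v)

    d : Fin n → Fin n → ℕ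
    d u v = proj₁ (shortest u v)

    Resolving : Subset n → Set
    Resolving W = ∀ y z → y ≢ z → ∃ λ x → x ∈ W × d y x ≢ d z x

    WeakTotalResolving : Subset n → Set
    WeakTotalResolving W =
      Resolving W ×
      (∀ w → w ∈ W → ∀ x → x ∉ W →
        ∃ λ w′ → w′ ∈ W × w′ ≢ w × d x w′ ≢ d w w′)

    resolving? : Decidable Resolving
    resolving? W = all? λ y → all? λ z → ¬? (y ≟ᶠ z) →-dec
      any? λ x → (x ∈? W) ×-dec ¬? (d y x ≟ d z x)

    weakTotalResolving? : Decidable WeakTotalResolving
    weakTotalResolving? W = resolving? W ×-dec
      (all? λ w → (w ∈? W) →-dec all? λ x → ¬? (x ∈? W) →-dec
        any? λ w′ → (w′ ∈? W) ×-dec ¬? (w′ ≟ᶠ w) ×-dec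
          ¬? (d x w′ ≟ d w w′))

    AllWeakTotalResolving : ℕ → Set
    AllWeakTotalResolving r = ∀ W → ∣ W ∣ ≡ r → WeakTotalResolving W

    -- The search for the minimum stops by suc n, where the condition is
    -- vacuous.  The set of all vertices is weak total resolving, so if there
    -- is a vertex then the minimum is at most n and is never attained
    -- vacuously.
    leastPositive :
      ∃ (Least (λ r → 1 ≤ r × AllWeakTotalResolving r))
    leastPositive = least
      (λ r → (1 ≤? r) ×-dec
        allSubset? (λ W → (∣ W ∣ ≟ r) →-dec weakTotalResolving? W))
      (suc n)
      (s≤s z≤n , λ W ∣W∣≡1+n → ⊥-elim (1+n≰n (subst (_≤ n) ∣W∣≡1+n (∣p∣≤n W))))

    res-wt : ℕ
    res-wt = proj₁ leastPositive

path : ∀ n → Graph n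
path n = record
  { Adj     = λ i j → Next i j ⊎ Next j i
  ; adj?    = λ i j → next? i j ⊎-dec next? j i
  ; adj-sym = Sum.swap
  ; irrefl  = λ i → [ 1+n≢n ∘ sym , 1+n≢n ∘ sym ]
  }
  where
  Next : Rel (Fin n) 0ℓ
  Next i j = toℕ j ≡ suc (toℕ i)

  next? : Decidable₂ Next
  next? i j = toℕ j ≟ suc (toℕ i)

cycle : ∀ n → 3 ≤ n → Graph n
cycle n 3≤n = record
  { Adj     = λ i j → Next i j ⊎ Next j i
  ; adj?    = λ i j → next? i j ⊎-dec next? j i
  ; adj-sym = Sum.swap
  ; irrefl  = λ i → [ next-irrefl i , next-irrefl i ]
  }
  where
  -- j = i + 1 modulo n
  Next : Rel (Fin n) 0ℓ
  Next i j = toℕ j ≡ suc (toℕ i) ⊎ (suc (toℕ i) ≡ n × toℕ j ≡ 0)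

  next? : Decidable₂ Next
  next? i j = (toℕ j ≟ suc (toℕ i)) ⊎-dec
              ((suc (toℕ i) ≟ n) ×-dec (toℕ j ≟ 0))

  3≰1 : ¬ 3 ≤ 1
  3≰1 (s≤s ())

  next-irrefl : ∀ i → ¬ Next i i
  next-irrefl i (inj₁ i≡1+i)       = 1+n≢n (sym i≡1+i)
  next-irrefl i (inj₂ (1+i≡n , i≡0)) =
    3≰1 (subst (3 ≤_) (trans (sym 1+i≡n) (cong suc i≡0)) 3≤n)

IsOddCycle : ∀ {n} → Graph n → Set
IsOddCycle {n} G = 2 ∤ n × Σ (3 ≤ n) λ 3≤n → G ≅ cycle n 3≤n

IsPath : ∀ {n} → Graph n → Set
IsPath {n} G = G ≅ path n

{-# OPTIONS --safe #-}

-- The weak total resolving number is 3 exactly when n ≥ 3 and no two vertices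
-- y ≠ z have two equidistant vertices a ≠ b: otherwise {y, a, b} does not
-- separate y from z, and if c has neighbours a ≠ b then {a, c} does not separate
-- a from b.  Under this condition a vertex has at most two neighbours, so that
-- a maximal trail exhausts the graph, which is a path or a cycle; an even cycle
-- is excluded by a reflection fixing two antipodal vertices.  Conversely, give
-- the vertices of a path or an odd cycle coordinates φ in ℤ or ℤ/n.  A shortest
-- walk from u to v of length k does not turn back, so φ v = φ u ± k; thus a
-- vertex a equidistant from y ≠ z satisfies 2 φ a = φ y + φ z, and 2 is
-- cancellable.

module Submission where

open import Defs
open import Data.Nat using (ℕ; _≤_)
open import Data.Product using (_×_)
open import Data.Sum using (_⊎_)
open import Function using (_⇔_)
open import Relation.Binary.PropositionalEquality using (_≡_)

open import Data.Empty using (⊥; ⊥-elim)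
open import Data.Fin using (Fin; zero; suc; toℕ; fromℕ<; opposite)
open import Data.Fin.Properties
  using (any?; toℕ<n; toℕ-injective; toℕ-fromℕ<; fromℕ<-injective; injective⇒≤;
         opposite-prop; opposite-involutive)
  renaming (_≟_ to _≟ᶠ_)
open import Data.Fin.Subset using (Subset; inside; outside; _∈_; _∉_; ∣_∣; ⁅_⁆; _∪_; _-_; Nonempty; ⊤)
open import Data.Fin.Subset.Properties
  using (∪-identityˡ; p─⊥≡p; p─q⊆p; x∈⁅x⁆; x∈⁅y⁆⇒x≡y; x∈p∪q⁺; x∈p∪q⁻;
         ∣⁅x⁆∣≡1; ∣⊥∣≡0; ∣p∣≤n; ∣p∣≡n⇒p≡⊤; ∈⊤;
         nonempty?; Empty-unique)
open import Data.Integer using (ℤ; +_; 0ℤ; 1ℤ; -1ℤ)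
import Data.Integer as ℤ
import Data.Integer.Divisibility.Signed as ℤ
import Data.Integer.Properties as ℤ
open import Data.Integer.Tactic.RingSolver using (solve-∀)
open import Data.Nat
  using (zero; suc; _+_; _⊔_; _∸_; _<_; z≤n; s≤s; z<s; s≤s⁻¹; _≟_)
open import Data.Nat.Coprimality using (Coprime; coprime-divisor)
open import Data.Nat.Divisibility using (_∤_; _∣_; divides; ∣⇒≤; >⇒∤; 0∣⇒≡0)
open import Data.Nat.Properties hiding (_≟_)
open import Data.Product using (Σ; _,_; ∃; proj₁; proj₂)
open import Data.Sum using (inj₁; inj₂; [_,_]′)
import Data.Sum as Sum
open import Data.Vec using (_∷_; here; there)
open import Function using (_∘_; id; mk⇔; mk↔ₛ′; Equivalence; Inverse)
open import Relation.Binary.Definitions using (tri<; tri≈; tri>)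
open import Relation.Binary.PropositionalEquality
  using (_≢_; refl; sym; trans; cong; cong₂; subst; subst₂)
open import Relation.Nullary using (¬_; Dec; yes; no; contradiction; ¬?; _×-dec_)

-- Cardinalities of small subsets of `Fin n`.

x∉p⇒∣⁅x⁆∪p∣≡1+∣p∣ : ∀ {n} {x : Fin n} {p} → x ∉ p → ∣ ⁅ x ⁆ ∪ p ∣ ≡ suc ∣ p ∣
x∉p⇒∣⁅x⁆∪p∣≡1+∣p∣ {x = zero}  {inside  ∷ p} x∉p = contradiction here x∉p
x∉p⇒∣⁅x⁆∪p∣≡1+∣p∣ {x = zero}  {outside ∷ p} x∉p = cong (suc ∘ ∣_∣) (∪-identityˡ p)
x∉p⇒∣⁅x⁆∪p∣≡1+∣p∣ {x = suc x} {inside  ∷ p} x∉p = cong suc (x∉p⇒∣⁅x⁆∪p∣≡1+∣p∣ (x∉p ∘ there))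
x∉p⇒∣⁅x⁆∪p∣≡1+∣p∣ {x = suc x} {outside ∷ p} x∉p = x∉p⇒∣⁅x⁆∪p∣≡1+∣p∣ (x∉p ∘ there)

x∈p⇒∣p∣≡1+∣p-x∣ : ∀ {n} {x : Fin n} {p} → x ∈ p → ∣ p ∣ ≡ suc ∣ p - x ∣
x∈p⇒∣p∣≡1+∣p-x∣ {p = inside  ∷ p} here        = cong (suc ∘ ∣_∣) (sym (p─⊥≡p p))
x∈p⇒∣p∣≡1+∣p-x∣ {p = inside  ∷ p} (there x∈p) = cong suc (x∈p⇒∣p∣≡1+∣p-x∣ x∈p)
x∈p⇒∣p∣≡1+∣p-x∣ {p = outside ∷ p} (there x∈p) = x∈p⇒∣p∣≡1+∣p-x∣ x∈p

x∈p-y⇒x≢y : ∀ {n} {x} (y : Fin n) p → x ∈ p - y → x ≢ y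
x∈p-y⇒x≢y zero    (_ ∷ p) ()         refl
x∈p-y⇒x≢y (suc y) (_ ∷ p) (there x∈) refl = x∈p-y⇒x≢y y p x∈ refl

pair-member : ∀ {n} {x a b : Fin n} → x ∈ ⁅ a ⁆ ∪ ⁅ b ⁆ → x ≡ a ⊎ x ≡ b
pair-member {a = a} {b} = [ inj₁ ∘ x∈⁅y⁆⇒x≡y a , inj₂ ∘ x∈⁅y⁆⇒x≡y b ]′ ∘ x∈p∪q⁻ ⁅ a ⁆ ⁅ b ⁆

∣pair∣≡2 : ∀ {n} {a b : Fin n} → a ≢ b → ∣ ⁅ a ⁆ ∪ ⁅ b ⁆ ∣ ≡ 2
∣pair∣≡2 {a = a} {b} a≢b =
  trans (x∉p⇒∣⁅x⁆∪p∣≡1+∣p∣ (a≢b ∘ x∈⁅y⁆⇒x≡y b)) (cong suc (∣⁅x⁆∣≡1 b))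

nonempty : ∀ {n k} {p : Subset n} → ∣ p ∣ ≡ suc k → Nonempty p
nonempty {n} {p = p} eq with nonempty? p
... | yes ne = ne
... | no ¬ne with Empty-unique ¬ne
...   | refl = contradiction (trans (sym eq) (∣⊥∣≡0 n)) 1+n≢0

record TwoMembers {n} (p : Subset n) : Set where
  constructor twoMembers
  field
    {a b} : Fin n
    a∈p   : a ∈ p
    b∈p   : b ∈ p
    a≢b   : a ≢ b

two-members : ∀ {n k} {p : Subset n} → ∣ p ∣ ≡ 2 + k → TwoMembers p
two-members {p = p} eq with nonempty eq
... | a , a∈p with nonempty (suc-injective (trans (sym (x∈p⇒∣p∣≡1+∣p-x∣ a∈p)) eq))
...   | b , b∈p-a = twoMembers a∈p (p─q⊆p p ⁅ a ⁆ b∈p-a) (x∈p-y⇒x≢y a p b∈p-a ∘ sym)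

-- Distances, and the value 3 in terms of unique equidistant vertices.

module Distance {n : ℕ} (G : Graph n) (connected : Connected G) where
  open Graph G

  dist : Fin n → Fin n → ℕ
  dist = d G connected

  geodesic : ∀ u v → Walk G u v (dist u v)
  geodesic u v = proj₁ (proj₂ (shortest G connected u v))

  dist-≤ : ∀ {u v k} → Walk G u v k → dist u v ≤ k
  dist-≤ {u} {v} = proj₂ (proj₂ (shortest G connected u v)) _

  dist-refl : ∀ u → dist u u ≡ 0
  dist-refl u = n≤0⇒n≡0 (dist-≤ [])

  dist≡0⇒≡ : ∀ {u v} → dist u v ≡ 0 → u ≡ v
  dist≡0⇒≡ {u} {v} eq with dist u v | geodesic u v
  dist≡0⇒≡ refl | .0 | [] = refl

  snoc : ∀ {u v w k} → Walk G u v k → Adj v w → Walk G u w (suc k)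
  snoc []      b = b ∷ []
  snoc (a ∷ p) b = a ∷ snoc p b

  reverse : ∀ {u v k} → Walk G u v k → Walk G v u k
  reverse []      = []
  reverse (a ∷ p) = snoc (reverse p) (adj-sym a)

  dist-sym : ∀ u v → dist u v ≡ dist v u
  dist-sym u v = ≤-antisym (dist-≤ (reverse (geodesic v u))) (dist-≤ (reverse (geodesic u v)))

  adj⇒≢ : ∀ {u v} → Adj u v → u ≢ v
  adj⇒≢ a refl = irrefl _ a

  adj⇒dist≡1 : ∀ {u v} → Adj u v → dist u v ≡ 1
  adj⇒dist≡1 a = ≤-antisym (dist-≤ (a ∷ [])) (n≢0⇒n>0 (adj⇒≢ a ∘ dist≡0⇒≡))

  UniquelyEquidistant : Set
  UniquelyEquidistant = ∀ {y z a b} → y ≢ z → dist y a ≡ dist z a → dist y b ≡ dist z b → a ≡ b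

  Cherry : Set
  Cherry = Σ (Fin n) λ c → Σ (Fin n) λ a → Σ (Fin n) λ b → Adj a c × Adj b c × a ≢ b

  ⊤-weakTotalResolving : WeakTotalResolving G connected ⊤
  ⊤-weakTotalResolving =
      (λ y z y≢z → y , ∈⊤ , λ eq → y≢z (sym (dist≡0⇒≡ (trans (sym eq) (dist-refl y)))))
    , λ _ _ x x∉⊤ → contradiction ∈⊤ x∉⊤

  -- Only the full vertex set can have so many elements. With `r = 2` this shows that graphs on at
  -- most two vertices have a number below 3.
  allWeakTotalResolving-≥ : ∀ {r} → n ≤ r → AllWeakTotalResolving G connected r
  allWeakTotalResolving-≥ n≤r W eq =
    subst (WeakTotalResolving G connected) (sym (∣p∣≡n⇒p≡⊤ ∣W∣≡n)) ⊤-weakTotalResolving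
    where ∣W∣≡n = ≤-antisym (∣p∣≤n W) (≤-trans n≤r (≤-reflexive (sym eq)))

  -- If `a ≢ b`, apply the hypothesis to `W` consisting of `y`, `a` and `b`. A vertex equidistant
  -- from `y` and `z` is neither of them, as it would have distance 0 to both; so `W` has three
  -- elements and omits `z`. Only `a` and `b` remain to separate `z` from `y`, and neither does.
  allTriples⇒uniquelyEquidistant : AllWeakTotalResolving G connected 3 → UniquelyEquidistant
  allTriples⇒uniquelyEquidistant all {y} {z} {a} {b} y≢z ya≡za yb≡zb with a ≟ᶠ b
  ... | yes a≡b = a≡b
  ... | no  a≢b = ⊥-elim (separated (proj₂ (all W ∣W∣≡3) y y∈W z z∉W))
    where
    y≢equi : ∀ {x} → dist y x ≡ dist z x → y ≢ x
    y≢equi eq refl = y≢z (sym (dist≡0⇒≡ (trans (sym eq) (dist-refl y))))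

    z≢equi : ∀ {x} → dist y x ≡ dist z x → z ≢ x
    z≢equi eq refl = y≢z (dist≡0⇒≡ (trans eq (dist-refl z)))

    W = ⁅ y ⁆ ∪ (⁅ a ⁆ ∪ ⁅ b ⁆)

    W-member : ∀ {x} → x ∈ W → x ≡ y ⊎ (x ≡ a ⊎ x ≡ b)
    W-member = [ inj₁ ∘ x∈⁅y⁆⇒x≡y y , inj₂ ∘ pair-member ]′ ∘ x∈p∪q⁻ ⁅ y ⁆ _

    y∈W : y ∈ W
    y∈W = x∈p∪q⁺ (inj₁ (x∈⁅x⁆ y))

    ∣W∣≡3 : ∣ W ∣ ≡ 3
    ∣W∣≡3 = trans
      (x∉p⇒∣⁅x⁆∪p∣≡1+∣p∣ ([ y≢equi ya≡za , y≢equi yb≡zb ]′ ∘ pair-member))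
      (cong suc (∣pair∣≡2 a≢b))

    z∉W : z ∉ W
    z∉W = [ y≢z ∘ sym , [ z≢equi ya≡za , z≢equi yb≡zb ]′ ]′ ∘ W-member

    separated : ¬ ∃ λ w′ → w′ ∈ W × w′ ≢ y × dist z w′ ≢ dist y w′
    separated (w′ , w′∈W , w′≢y , zw′≢yw′) with W-member w′∈W
    ... | inj₁ w′≡y        = w′≢y w′≡y
    ... | inj₂ (inj₁ refl) = zw′≢yw′ (sym ya≡za)
    ... | inj₂ (inj₂ refl) = zw′≢yw′ (sym yb≡zb)

  module _ (unique : UniquelyEquidistant) where

    separator : ∀ {y z p} → y ≢ z → TwoMembers p → ∃ λ x → x ∈ p × dist y x ≢ dist z x
    separator {y} {z} y≢z (twoMembers {a} {b} a∈p b∈p a≢b) with dist y a ≟ dist z a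
    ... | no  ya≢za = a , a∈p , ya≢za
    ... | yes ya≡za = b , b∈p , a≢b ∘ unique y≢z ya≡za

    -- Of any two members of `W`, at least one separates two given distinct vertices. Removing `w`
    -- from three members still leaves two.
    uniquelyEquidistant⇒allTriples : AllWeakTotalResolving G connected 3
    uniquelyEquidistant⇒allTriples W ∣W∣≡3 =
        (λ y z y≢z → separator y≢z (two-members ∣W∣≡3))
      , λ w w∈W x x∉W →
          let w′ , w′∈W-w , xw′≢ww′ = separator (x∉W ∘ λ x≡w → subst (_∈ W) (sym x≡w) w∈W)
                (two-members (suc-injective (trans (sym (x∈p⇒∣p∣≡1+∣p-x∣ w∈W)) ∣W∣≡3)))
          in w′ , p─q⊆p W ⁅ w ⁆ w′∈W-w , x∈p-y⇒x≢y w W w′∈W-w , xw′≢ww′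

  -- The singleton of `a` offers no `w′` other than `a`. In the pair of `a` and `c` the only
  -- candidate is `c`, at distance 1 from both `a` and `b`.
  cherry⇒3≤ : Cherry → ∀ {r} → 1 ≤ r → AllWeakTotalResolving G connected r → 3 ≤ r
  cherry⇒3≤ (c , a , b , ac , bc , a≢b) {1} _ all
    with proj₂ (all ⁅ a ⁆ (∣⁅x⁆∣≡1 a)) a (x∈⁅x⁆ a) b (a≢b ∘ sym ∘ x∈⁅y⁆⇒x≡y a)
  ... | w′ , w′∈ , w′≢a , _ = contradiction (x∈⁅y⁆⇒x≡y a w′∈) w′≢a
  cherry⇒3≤ (c , a , b , ac , bc , a≢b) {2} _ all
    with proj₂ (all (⁅ a ⁆ ∪ ⁅ c ⁆) (∣pair∣≡2 (adj⇒≢ ac))) a (x∈p∪q⁺ (inj₁ (x∈⁅x⁆ a)))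
               b ([ a≢b ∘ sym , adj⇒≢ bc ]′ ∘ pair-member)
  ... | w′ , w′∈ , w′≢a , ne with pair-member w′∈
  ...   | inj₁ w′≡a = contradiction w′≡a w′≢a
  ...   | inj₂ refl = contradiction (trans (adj⇒dist≡1 bc) (sym (adj⇒dist≡1 ac))) ne
  cherry⇒3≤ _ {suc (suc (suc r))} _ _ = s≤s (s≤s (s≤s z≤n))

  res-wt-least : Least (λ r → 1 ≤ r × AllWeakTotalResolving G connected r) (res-wt G connected)
  res-wt-least = proj₂ (leastPositive G connected)

  res-wt≡3⇒ : res-wt G connected ≡ 3 → UniquelyEquidistant × 3 ≤ n
  res-wt≡3⇒ eq with subst (Least _) eq res-wt-least
  ... | (_ , all) , min = allTriples⇒uniquelyEquidistant all , ≰⇒> n≰2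
    where
    n≰2 : ¬ n ≤ 2
    n≰2 n≤2 = 1+n≰n (min 2 (s≤s z≤n , allWeakTotalResolving-≥ n≤2))

  res-wt≡3⇐ : UniquelyEquidistant → Cherry → res-wt G connected ≡ 3
  res-wt≡3⇐ unique cherry =
    let (1≤r , all) , min = res-wt-least
    in ≤-antisym (min 3 (s≤s z≤n , uniquelyEquidistant⇒allTriples unique))
                 (cherry⇒3≤ cherry 1≤r all)

-- Classification of connected graphs with at most two neighbours per vertex.

Next : ℕ → ℕ → Set
Next i j = j ≡ suc i

-- This and `Next` agree with the local relations in `cycle` and `path`, read on natural numbers so
-- that they apply to positions on a trail.
CyclicNext : ℕ → ℕ → ℕ → Set
CyclicNext n i j = Next i j ⊎ (suc i ≡ n × j ≡ 0)

module Classification {n : ℕ} (G : Graph n) (connected : Connected G) where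
  open Graph G
  open Distance G connected

  dist-common-neighbour : ∀ {c a b} → Adj c a → Adj c b → a ≢ b → dist a b ≡ 1 ⊎ dist a b ≡ 2
  dist-common-neighbour {c} {a} {b} ca cb a≢b
    with dist a b | dist-≤ (adj-sym ca ∷ (cb ∷ [])) | a≢b ∘ dist≡0⇒≡
  ... | 0 | _ | ≢0 = contradiction refl ≢0
  ... | 1 | _ | _  = inj₁ refl
  ... | 2 | _ | _  = inj₂ refl
  ... | suc (suc (suc _)) | s≤s (s≤s ()) | _

  AtMostTwoNeighbours : Set
  AtMostTwoNeighbours = ∀ {c x y z} → Adj c x → Adj c y → Adj c z → x ≢ y → z ≡ x ⊎ z ≡ y

  -- Two of the three distances between three neighbours of c agree, so that
  -- one neighbour, besides c, is equidistant from the other two.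
  uniquelyEquidistant⇒atMostTwoNeighbours : UniquelyEquidistant → AtMostTwoNeighbours
  uniquelyEquidistant⇒atMostTwoNeighbours unique {c} {x} {y} {z} cx cy cz x≢y with z ≟ᶠ x | z ≟ᶠ y
  ... | yes z≡x | _       = inj₁ z≡x
  ... | no _    | yes z≡y = inj₂ z≡y
  ... | no z≢x  | no z≢y  = ⊥-elim (pigeonhole
          (dist-common-neighbour cx cy x≢y)
          (dist-common-neighbour cx cz (z≢x ∘ sym))
          (dist-common-neighbour cy cz (z≢y ∘ sym)))
    where
    not-equidistant : ∀ {u v w} → Adj c u → Adj c v → Adj c w → v ≢ w → dist u v ≢ dist u w
    not-equidistant {u} {v} {w} cu cv cw v≢w uv≡uw = adj⇒≢ cu (unique v≢w
      (trans (adj⇒dist≡1 (adj-sym cv)) (sym (adj⇒dist≡1 (adj-sym cw))))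
      (trans (dist-sym v u) (trans uv≡uw (dist-sym u w))))

    xy≢xz : dist x y ≢ dist x z
    xy≢xz = not-equidistant cx cy cz (z≢y ∘ sym)

    xy≢yz : dist x y ≢ dist y z
    xy≢yz = not-equidistant cy cx cz (z≢x ∘ sym) ∘ trans (dist-sym y x)

    xz≢yz : dist x z ≢ dist y z
    xz≢yz eq = not-equidistant cz cx cy x≢y (trans (dist-sym z x) (trans eq (dist-sym y z)))

    pigeonhole : dist x y ≡ 1 ⊎ dist x y ≡ 2 → dist x z ≡ 1 ⊎ dist x z ≡ 2 →
                 dist y z ≡ 1 ⊎ dist y z ≡ 2 → ⊥
    pigeonhole (inj₁ p) (inj₁ q) _        = xy≢xz (trans p (sym q))
    pigeonhole (inj₂ p) (inj₂ q) _        = xy≢xz (trans p (sym q))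
    pigeonhole (inj₁ p) _        (inj₁ r) = xy≢yz (trans p (sym r))
    pigeonhole (inj₂ p) _        (inj₂ r) = xy≢yz (trans p (sym r))
    pigeonhole _        (inj₁ q) (inj₁ r) = xz≢yz (trans q (sym r))
    pigeonhole _        (inj₂ q) (inj₂ r) = xz≢yz (trans q (sym r))

  -- Only the values f 0, …, f k matter.
  record Trail (k : ℕ) : Set where
    field
      f         : ℕ → Fin n
      injective : ∀ {i j} → i ≤ k → j ≤ k → f i ≡ f j → i ≡ j
      step      : ∀ {i} → i < k → Adj (f i) (f (suc i))

    Covered : Fin n → Set
    Covered v = ∃ λ i → i ≤ k × f i ≡ v

    covered? : ∀ v → Dec (Covered v)
    covered? v with anyUpTo? (λ i → f i ≟ᶠ v) (suc k)
    ... | yes (i , i<1+k , eq) = yes (i , s≤s⁻¹ i<1+k , eq)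
    ... | no ¬∃ = no λ (i , i≤k , eq) → ¬∃ (i , s≤s i≤k , eq)

    k<n : k < n
    k<n = injective⇒≤ {f = f ∘ toℕ {suc k}} λ {i} {j} →
      toℕ-injective ∘ injective (s≤s⁻¹ (toℕ<n i)) (s≤s⁻¹ (toℕ<n j))

    Closed : Fin n → Set
    Closed u = ∀ v → Adj u v → Covered v

    closed? : ∀ u → Closed u ⊎ ∃ λ v → Adj u v × ¬ Covered v
    closed? u with any? (λ v → adj? u v ×-dec ¬? (covered? v))
    ... | yes ext = inj₂ ext
    ... | no ¬ext = inj₁ λ v uv → closed v uv (covered? v)
      where
      closed : ∀ v → Adj u v → Dec (Covered v) → Covered v
      closed v uv (yes c) = c
      closed v uv (no ¬c) = contradiction (v , uv , ¬c) ¬ext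

  open Trail

  trivial : Fin n → Trail 0
  trivial v = record
    { f         = λ _ → v
    ; injective = λ { z≤n z≤n _ → refl }
    ; step      = λ ()
    }

  extend : ∀ {k} (t : Trail k) {v} → Adj (f t 0) v → ¬ Covered t v → Trail (suc k)
  extend {k} t {v} a ¬c = record { f = g ; injective = g-injective ; step = g-step }
    where
    g : ℕ → Fin n
    g zero    = v
    g (suc i) = f t i

    g-injective : ∀ {i j} → i ≤ suc k → j ≤ suc k → g i ≡ g j → i ≡ j
    g-injective {zero}  {zero}  _         _         _  = refl
    g-injective {zero}  {suc j} _         (s≤s j≤k) eq = contradiction (j , j≤k , sym eq) ¬c
    g-injective {suc i} {zero}  (s≤s i≤k) _         eq = contradiction (i , i≤k , eq) ¬c
    g-injective {suc i} {suc j} (s≤s i≤k) (s≤s j≤k) eq = cong suc (injective t i≤k j≤k eq)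

    g-step : ∀ {i} → i < suc k → Adj (g i) (g (suc i))
    g-step {zero}  _         = adj-sym a
    g-step {suc i} (s≤s i<k) = step t i<k

  flip : ∀ {k} → Trail k → Trail k
  flip {k} t = record
    { f         = λ i → f t (k ∸ i)
    ; injective = λ {i} {j} i≤k j≤k eq →
        ∸-cancelˡ-≡ i≤k j≤k (injective t (m∸n≤m k i) (m∸n≤m k j) eq)
    ; step      = λ {i} i<k → adj-sym
        (subst (Adj (f t (k ∸ suc i)) ∘ f t) (sym (+-∸-assoc 1 i<k))
          (step t (∸-monoʳ-< z<s i<k)))
    }

  Maximal : ∀ {k} → Trail k → Set
  Maximal {k} t = Closed t (f t 0) × Closed t (f t k)

  -- The fuel bounds the number of vertices not covered yet.
  grow : ∀ fuel {k} → n ≤ fuel + k → Trail k → ∃ λ k′ → Σ (Trail k′) Maximal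
  grow zero       n≤k t = contradiction (k<n t) (≤⇒≯ n≤k)
  grow (suc fuel) {k} n≤ t with closed? t (f t 0)
  ... | inj₂ (v , a , ¬c) = grow fuel (subst (n ≤_) (sym (+-suc fuel k)) n≤) (extend t a ¬c)
  ... | inj₁ closed₀ with closed? t (f t k)
  ...   | inj₁ closedₖ      = k , t , closed₀ , closedₖ
  -- `extend` adds a vertex only in front, so the trail is reversed to grow at its last vertex.
  ...   | inj₂ (v , a , ¬c) = grow fuel (subst (n ≤_) (sym (+-suc fuel k)) n≤)
            (extend (flip t) a (¬c ∘ λ (i , i≤k , eq) → k ∸ i , m∸n≤m k i , eq))

  module _ (≤2 : AtMostTwoNeighbours) {k} (t : Trail k) (maximal : Maximal t) where
    private
      p : ℕ → Fin n
      p = f t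

    -- The predecessor and the successor on the trail are already two distinct neighbours, which
    -- leaves no room for a third.
    inner-neighbours : ∀ {i v} → suc i < k → Adj (p (suc i)) v → v ≡ p i ⊎ v ≡ p (2 + i)
    inner-neighbours {i} i<k a = ≤2 (adj-sym (step t (<-trans (n<1+n i) i<k))) (step t i<k) a
      λ eq → contradiction (injective t (≤-trans (n≤1+n i) (<⇒≤ i<k)) i<k eq) λ ()

    -- At the two ends this is maximality; at an inner vertex both neighbours lie on the trail.
    closed : ∀ {i} → i ≤ k → Closed t (p i)
    closed {zero}  _ = proj₁ maximal
    closed {suc i} i≤k v a with m≤n⇒m<n∨m≡n i≤k
    ... | inj₂ refl = proj₂ maximal v a
    ... | inj₁ i<k with inner-neighbours i<k a
    ...   | inj₁ refl = i , ≤-trans (n≤1+n i) i≤k , refl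
    ...   | inj₂ refl = 2 + i , i<k , refl

    walk-covered : ∀ {i v l} → i ≤ k → Walk G (p i) v l → Covered t v
    walk-covered i≤k []      = _ , i≤k , refl
    walk-covered i≤k (a ∷ w) with closed i≤k _ a
    ... | j , j≤k , refl = walk-covered j≤k w

    -- A walk starting at `p 0` can never leave the trail, and by connectedness walks reach every
    -- vertex.
    covered : ∀ v → Covered t v
    covered v = walk-covered z≤n (proj₂ (connected (p 0) v))

    index : Fin n → ℕ
    index = proj₁ ∘ covered

    index≤k : ∀ v → index v ≤ k
    index≤k = proj₁ ∘ proj₂ ∘ covered

    p-index : ∀ v → p (index v) ≡ v
    p-index = proj₂ ∘ proj₂ ∘ covered

    n≡1+k : n ≡ suc k
    n≡1+k = ≤-antisym (injective⇒≤ {f = λ v → fromℕ< (s≤s (index≤k v))} λ {u} {v} eq →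
        trans (sym (p-index u)) (trans (cong p (fromℕ<-injective _ _ _ _ eq)) (p-index v)))
      (k<n t)

    -- If one end of the edge is an inner vertex of the trail, the other is its predecessor or
    -- successor there. What remains is an edge joining the two ends of the trail.
    adj-ends : ∀ {i j} → i < j → j ≤ k → Adj (p i) (p j) → j ≡ suc i ⊎ (suc j ≡ n × i ≡ 0)
    adj-ends {suc i} i<j j≤k a with inner-neighbours (<-≤-trans i<j j≤k) a
    ... | inj₁ eq = contradiction (injective t j≤k (≤-trans (n≤1+n i) (<⇒≤ (<-≤-trans i<j j≤k))) eq)
                      (<⇒≢ (<-trans (n<1+n i) i<j) ∘ sym)
    ... | inj₂ eq = inj₁ (injective t j≤k (<-≤-trans i<j j≤k) eq)
    adj-ends {zero} {suc j} i<j j≤k a with m≤n⇒m<n∨m≡n j≤k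
    ... | inj₂ refl = inj₂ (sym n≡1+k , refl)
    ... | inj₁ j<k with inner-neighbours j<k (adj-sym a)
    ...   | inj₁ eq = inj₁ (cong suc (sym (injective t z≤n (≤-trans (n≤1+n j) j≤k) eq)))
    ...   | inj₂ eq = contradiction (injective t z≤n j<k eq) λ ()

    adj⇒cyclicNext : ∀ {i j} → i ≤ k → j ≤ k → Adj (p i) (p j) → CyclicNext n i j ⊎ CyclicNext n j i
    adj⇒cyclicNext {i} {j} i≤k j≤k a with <-cmp i j
    ... | tri< i<j _ _  = Sum.map inj₁ inj₂ (adj-ends i<j j≤k a)
    ... | tri≈ _ refl _ = contradiction a (irrefl _)
    ... | tri> _ _ j<i  = Sum.swap (Sum.map inj₁ inj₂ (adj-ends j<i i≤k (adj-sym a)))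

    next⇒adj : ∀ {i j} → j ≤ k → Next i j → Adj (p i) (p j)
    next⇒adj j≤k refl = step t j≤k

    module _ (H : Graph n) (R : ℕ → ℕ → Set)
             (H-adj : ∀ {u v} → Graph.Adj H u v ⇔ (R (toℕ u) (toℕ v) ⊎ R (toℕ v) (toℕ u)))
             (adj⇒R : ∀ {i j} → i ≤ k → j ≤ k → Adj (p i) (p j) → R i j ⊎ R j i)
             (R⇒adj : ∀ {i j} → i ≤ k → j ≤ k → R i j → Adj (p i) (p j)) where

      private
        to : Fin n → Fin n
        to v = fromℕ< (subst (index v <_) (sym n≡1+k) (s≤s (index≤k v)))

        toℕ-to : ∀ v → toℕ (to v) ≡ index v
        toℕ-to v = toℕ-fromℕ< _

        toℕ≤k : ∀ (i : Fin n) → toℕ i ≤ k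
        toℕ≤k i = s≤s⁻¹ (subst (toℕ i <_) n≡1+k (toℕ<n i))

        to-from : ∀ i → to (p (toℕ i)) ≡ i
        to-from i = toℕ-injective (trans (toℕ-to _)
          (injective t (index≤k _) (toℕ≤k i) (p-index _)))

        R⇒adj′ : ∀ {u v} → R (index u) (index v) → Adj u v
        R⇒adj′ {u} {v} = subst₂ Adj (p-index u) (p-index v) ∘ R⇒adj (index≤k u) (index≤k v)

        adj⇔R : ∀ u v → Adj u v ⇔ (R (index u) (index v) ⊎ R (index v) (index u))
        adj⇔R u v = mk⇔
          (adj⇒R (index≤k u) (index≤k v) ∘ subst₂ Adj (sym (p-index u)) (sym (p-index v)))
          [ R⇒adj′ , adj-sym ∘ R⇒adj′ ]′

      -- A vertex is sent to its position on the trail. Keeping `R` arbitrary lets the path and the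
      -- cycle share the construction.
      trail-iso : G ≅ H
      trail-iso = record
        { bijection = mk↔ₛ′ to (p ∘ toℕ) to-from (λ v → trans (cong p (toℕ-to v)) (p-index v))
        ; adj⇔      = λ u v → mk⇔
            (Equivalence.from H-adj ∘ subst₂ R± (sym (toℕ-to u)) (sym (toℕ-to v)) ∘
              Equivalence.to (adj⇔R u v))
            (Equivalence.from (adj⇔R u v) ∘ subst₂ R± (toℕ-to u) (toℕ-to v) ∘ Equivalence.to H-adj)
        }
        where
        R± : ℕ → ℕ → Set
        R± i j = R i j ⊎ R j i

    -- All adjacencies are determined except the one between the two ends of the trail, which
    -- decides between cycle and path.
    iso-path-or-cycle : ∀ 3≤n → G ≅ path n ⊎ G ≅ cycle n 3≤n
    iso-path-or-cycle 3≤n with adj? (p k) (p 0)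
    ... | yes a = inj₂ (trail-iso (cycle n 3≤n) (CyclicNext n) (mk⇔ id id) adj⇒cyclicNext cyclicNext⇒adj)
      where
      cyclicNext⇒adj : ∀ {i j} → i ≤ k → j ≤ k → CyclicNext n i j → Adj (p i) (p j)
      cyclicNext⇒adj i≤k j≤k (inj₁ i→j)            = next⇒adj j≤k i→j
      cyclicNext⇒adj i≤k j≤k (inj₂ (1+i≡n , refl)) =
        subst (λ i → Adj (p i) (p 0)) (suc-injective (trans (sym n≡1+k) (sym 1+i≡n))) a
    ... | no ¬a = inj₁ (trail-iso (path n) Next (mk⇔ id id) adj⇒next (λ _ → next⇒adj))
      where
      cyclicNext⇒next : ∀ {i j} → Adj (p i) (p j) → CyclicNext n i j → Next i j
      cyclicNext⇒next _ (inj₁ i→j) = i→j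
      cyclicNext⇒next a (inj₂ (1+i≡n , refl)) = contradiction
        (subst (λ i → Adj (p i) (p 0)) (suc-injective (trans 1+i≡n n≡1+k)) a) ¬a

      adj⇒next : ∀ {i j} → i ≤ k → j ≤ k → Adj (p i) (p j) → Next i j ⊎ Next j i
      adj⇒next i≤k j≤k a = Sum.map (cyclicNext⇒next a) (cyclicNext⇒next (adj-sym a)) (adj⇒cyclicNext i≤k j≤k a)

  path-or-cycle : AtMostTwoNeighbours → ∀ 3≤n → G ≅ path n ⊎ G ≅ cycle n 3≤n
  path-or-cycle ≤2 3≤n =
    let k , t , maximal = grow n (m≤m+n n 0) (trivial (fromℕ< 3≤n′))
    in iso-path-or-cycle ≤2 t maximal 3≤n
    where 3≤n′ = ≤-trans (s≤s z≤n) 3≤n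

  module _ (τ : Fin n → Fin n) (τ-adj : ∀ {u v} → Adj u v → Adj (τ u) (τ v))
           (τ-involutive : ∀ u → τ (τ u) ≡ u) where

    map-walk : ∀ {u v k} → Walk G u v k → Walk G (τ u) (τ v) k
    map-walk []      = []
    map-walk (a ∷ p) = τ-adj a ∷ map-walk p

    -- `τ` maps walks to walks of the same length, and being its own inverse it also maps them back.
    dist-involution : ∀ u v → dist u v ≡ dist (τ u) (τ v)
    dist-involution u v = ≤-antisym
      (dist-≤ (subst₂ (λ u v → Walk G u v (dist (τ _) (τ _))) (τ-involutive u) (τ-involutive v)
        (map-walk (geodesic (τ u) (τ v)))))
      (dist-≤ (map-walk (geodesic u v)))

-- Isomorphisms, and the reflection that excludes even cycles.

module Iso {m n} {G : Graph m} {H : Graph n} (iso : G ≅ H) where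
  open _≅_ iso public using (to; from; adj⇔)
  open Inverse (_≅_.bijection iso) public using (strictlyInverseˡ; strictlyInverseʳ)

  to-injective : ∀ {u v} → to u ≡ to v → u ≡ v
  to-injective {u} {v} eq = trans (sym (strictlyInverseʳ u)) (trans (cong from eq) (strictlyInverseʳ v))

  from-injective : ∀ {i j} → from i ≡ from j → i ≡ j
  from-injective {i} {j} eq = trans (sym (strictlyInverseˡ i)) (trans (cong to eq) (strictlyInverseˡ j))

  to-adj : ∀ {u v} → Graph.Adj G u v → Graph.Adj H (to u) (to v)
  to-adj {u} {v} = Equivalence.to (adj⇔ u v)

  from-adj : ∀ {i j} → Graph.Adj H i j → Graph.Adj G (from i) (from j)
  from-adj {i} {j} = Equivalence.from (adj⇔ _ _) ∘
    subst₂ (Graph.Adj H) (sym (strictlyInverseˡ i)) (sym (strictlyInverseˡ j))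

-- i ↦ - i modulo n
reflect : ∀ {n} → Fin n → Fin n
reflect zero    = zero
reflect (suc i) = suc (opposite i)

reflect-involutive : ∀ {n} (i : Fin n) → reflect (reflect i) ≡ i
reflect-involutive zero    = refl
reflect-involutive (suc i) = cong suc (opposite-involutive i)

toℕ-reflect-suc : ∀ {n} (i : Fin n) → toℕ (reflect (suc i)) ≡ n ∸ toℕ i
toℕ-reflect-suc i = trans (cong suc (opposite-prop i)) (sym (+-∸-assoc 1 (toℕ<n i)))

toℕ-reflect : ∀ {n} (i : Fin n) → 0 < toℕ i → toℕ (reflect i) ≡ n ∸ toℕ i
toℕ-reflect (suc i) _ = toℕ-reflect-suc i

-- Negating `j = i + 1` gives `- i = - j + 1`, so the edge changes direction. Edges at 0 are treated
-- separately: there the wrap-around edge and the edge from 0 to 1 are exchanged.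
reflect-next : ∀ {n} (i j : Fin n) → CyclicNext n (toℕ i) (toℕ j) →
               CyclicNext n (toℕ (reflect j)) (toℕ (reflect i))
reflect-next zero    zero    next              = next
reflect-next (suc i) zero    (inj₂ (1+i≡n , _)) = inj₁ (trans (toℕ-reflect-suc i)
  (trans (cong (_∸ toℕ i) (suc-injective (sym 1+i≡n))) (m+n∸n≡m 1 (toℕ i))))
reflect-next zero    (suc j) (inj₁ j≡1)        = inj₂ (cong suc (trans (toℕ-reflect-suc j)
  (cong (_ ∸_) (suc-injective j≡1))) , refl)
reflect-next (suc i) (suc j) (inj₁ j≡1+i)      = inj₁ (trans (toℕ-reflect-suc i)
  (trans (+-∸-assoc 1 (subst (_≤ _) (suc-injective j≡1+i) (<⇒≤ (toℕ<n j))))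
    (cong suc (trans (cong (_ ∸_) (sym (suc-injective j≡1+i))) (sym (toℕ-reflect-suc j))))))

module _ {n : ℕ} (G : Graph n) (connected : Connected G) where
  open Graph G
  open Distance G connected
  open Classification G connected

  -- Both 0 and n / 2 are equidistant from 1 and - 1.
  uniquelyEquidistant⇒odd : UniquelyEquidistant → ∀ 3≤n → G ≅ cycle n 3≤n → 2 ∤ n
  uniquelyEquidistant⇒odd unique 3≤n iso (divides h n≡h*2) =
    contradiction (from-injective (unique from1≢from-1 equi₀ equiₕ)) 0≢h
    where
    open Iso iso

    h+h≡n : h + h ≡ n
    h+h≡n = trans (cong (λ x → h + x) (sym (+-identityʳ h))) (trans (*-comm 2 h) (sym n≡h*2))

    2≤h : 2 ≤ h
    2≤h = ≰⇒> λ h≤1 → 1+n≰n (≤-trans (s≤s (+-mono-≤ h≤1 h≤1)) (subst (3 ≤_) (sym h+h≡n) 3≤n))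

    h<n : h < n
    h<n = subst (h <_) h+h≡n (m<m+n h (<-trans z<s 2≤h))

    0ᶠ 1ᶠ hᶠ : Fin n
    0ᶠ = fromℕ< (<-≤-trans z<s 3≤n)
    1ᶠ = fromℕ< (<-≤-trans (s≤s z<s) 3≤n)
    hᶠ = fromℕ< h<n

    toℕ-0ᶠ : toℕ 0ᶠ ≡ 0
    toℕ-0ᶠ = toℕ-fromℕ< _

    toℕ-1ᶠ : toℕ 1ᶠ ≡ 1
    toℕ-1ᶠ = toℕ-fromℕ< _

    toℕ-hᶠ : toℕ hᶠ ≡ h
    toℕ-hᶠ = toℕ-fromℕ< _

    0≢h : 0ᶠ ≢ hᶠ
    0≢h eq = contradiction (trans (sym toℕ-0ᶠ) (trans (cong toℕ eq) toℕ-hᶠ)) (<⇒≢ (<-trans z<s 2≤h))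

    reflect-0ᶠ : reflect 0ᶠ ≡ 0ᶠ
    reflect-0ᶠ with 0ᶠ | toℕ-0ᶠ
    ... | zero | _ = refl

    reflect-hᶠ : reflect hᶠ ≡ hᶠ
    reflect-hᶠ = toℕ-injective (trans (toℕ-reflect hᶠ (subst (0 <_) (sym toℕ-hᶠ) (<-trans z<s 2≤h)))
      (trans (cong₂ _∸_ (sym h+h≡n) toℕ-hᶠ) (trans (m+n∸n≡m h h) (sym toℕ-hᶠ))))

    1≢-1 : 1ᶠ ≢ reflect 1ᶠ
    -- The index of `reflect 1ᶠ` is `n ∸ 1`, which is at least 2.
    1≢-1 eq = <⇒≢ (∸-monoˡ-≤ 1 3≤n) (trans (sym toℕ-1ᶠ) (trans (cong toℕ eq)
      (trans (toℕ-reflect 1ᶠ (subst (0 <_) (sym toℕ-1ᶠ) z<s)) (cong (n ∸_) toℕ-1ᶠ))))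

    from1≢from-1 : from 1ᶠ ≢ from (reflect 1ᶠ)
    from1≢from-1 = 1≢-1 ∘ from-injective

    τ : Fin n → Fin n
    τ = from ∘ reflect ∘ to

    τ-adj : ∀ {u v} → Adj u v → Adj (τ u) (τ v)
    τ-adj {u} {v} = from-adj ∘ Sum.swap ∘
      Sum.map (reflect-next (to u) (to v)) (reflect-next (to v) (to u)) ∘ to-adj

    τ-involutive : ∀ u → τ (τ u) ≡ u
    τ-involutive u = trans (cong (from ∘ reflect) (strictlyInverseˡ _))
      (trans (cong from (reflect-involutive (to u))) (strictlyInverseʳ u))

    τ-from : ∀ i → τ (from i) ≡ from (reflect i)
    τ-from i = cong (from ∘ reflect) (strictlyInverseˡ i)

    -- `τ` preserves distances, takes `from 1ᶠ` to `from (reflect 1ᶠ)` and fixes `from i`.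
    equi : ∀ {i} → reflect i ≡ i → dist (from 1ᶠ) (from i) ≡ dist (from (reflect 1ᶠ)) (from i)
    equi {i} fixed = trans (dist-involution τ τ-adj τ-involutive (from 1ᶠ) (from i))
      (cong₂ dist (τ-from 1ᶠ) (trans (τ-from i) (cong from fixed)))

    equi₀ : dist (from 1ᶠ) (from 0ᶠ) ≡ dist (from (reflect 1ᶠ)) (from 0ᶠ)
    equi₀ = equi reflect-0ᶠ

    equiₕ : dist (from 1ᶠ) (from hᶠ) ≡ dist (from (reflect 1ᶠ)) (from hᶠ)
    equiₕ = equi reflect-hᶠ

  uniquelyEquidistant⇒odd-cycle-or-path : UniquelyEquidistant → 3 ≤ n → IsOddCycle G ⊎ (IsPath G × 3 ≤ n)
  uniquelyEquidistant⇒odd-cycle-or-path unique 3≤n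
    with path-or-cycle (uniquelyEquidistant⇒atMostTwoNeighbours unique) 3≤n
  ... | inj₁ iso = inj₂ (iso , 3≤n)
  ... | inj₂ iso = inj₁ (uniquelyEquidistant⇒odd unique 3≤n iso , 3≤n , iso)

-- Integer coordinates and displacement along shortest walks.

∣-combine : ∀ {m x y z} → m ℤ.∣ x → m ℤ.∣ y → x ℤ.+ y ≡ z → m ℤ.∣ z
∣-combine m∣x m∣y refl = ℤ.∣m∣n⇒∣m+n m∣x m∣y

Sign : ℤ → Set
Sign s = s ≡ 1ℤ ⊎ s ≡ -1ℤ

sign-cases : ∀ {s t} → Sign s → Sign t → t ≡ s ⊎ t ≡ ℤ.- s
sign-cases (inj₁ refl) (inj₁ refl) = inj₁ refl
sign-cases (inj₁ refl) (inj₂ refl) = inj₂ refl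
sign-cases (inj₂ refl) (inj₁ refl) = inj₂ refl
sign-cases (inj₂ refl) (inj₂ refl) = inj₁ refl

-- Abstract because unfolding the reflected proofs makes type checking very slow.
abstract
  negate-step : ∀ x y → ℤ.- (x ℤ.- (1ℤ ℤ.+ y)) ≡ y ℤ.- (-1ℤ ℤ.+ x)
  negate-step = solve-∀

  same-direction : ∀ u w v s k → v ℤ.- (s ℤ.* k ℤ.+ w) ℤ.+ (w ℤ.- (s ℤ.+ u)) ≡
    v ℤ.- (s ℤ.* (1ℤ ℤ.+ k) ℤ.+ u)
  same-direction = solve-∀

  turn-back : ∀ u w w′ s → w′ ℤ.- (ℤ.- s ℤ.+ w) ℤ.+ (w ℤ.- (s ℤ.+ u)) ≡ w′ ℤ.- u
  turn-back = solve-∀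

  zero-displacement : ∀ u → 0ℤ ≡ u ℤ.- (1ℤ ℤ.* 0ℤ ℤ.+ u)
  zero-displacement = solve-∀

  difference : ∀ y z a k → a ℤ.- (k ℤ.+ z) ℤ.+ ℤ.- (a ℤ.- (k ℤ.+ y)) ≡ y ℤ.- z
  difference = solve-∀

  sum : ∀ y z a s k → a ℤ.- (s ℤ.* k ℤ.+ y) ℤ.+ (a ℤ.- (ℤ.- s ℤ.* k ℤ.+ z)) ≡
    + 2 ℤ.* a ℤ.- (y ℤ.+ z)
  sum = solve-∀

  double-difference : ∀ y z a b → + 2 ℤ.* a ℤ.- (y ℤ.+ z) ℤ.+ ℤ.- (+ 2 ℤ.* b ℤ.- (y ℤ.+ z)) ≡
    + 2 ℤ.* (a ℤ.- b)
  double-difference = solve-∀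

-- The modulus is 0 for a path and the order for a cycle.
module Coordinates {n : ℕ} (G : Graph n) (connected : Connected G) (m : ℤ) (φ : Fin n → ℤ) where
  open Graph G
  open Distance G connected

  infix 4 _≈_
  -- For `m = 0` this is equality, since 0 divides only 0.
  _≈_ : ℤ → ℤ → Set
  x ≈ y = m ℤ.∣ x ℤ.- y

  module _ (φ-injective : ∀ {u v} → φ u ≈ φ v → u ≡ v)
           (φ-step : ∀ {u v} → Adj u v → φ v ≈ 1ℤ ℤ.+ φ u ⊎ φ u ≈ 1ℤ ℤ.+ φ v)
           (halve : ∀ {x} → m ℤ.∣ + 2 ℤ.* x → m ℤ.∣ x) where

    signed-step : ∀ {u v} → Adj u v → ∃ λ s → Sign s × φ v ≈ s ℤ.+ φ u
    signed-step {u} {v} a with φ-step a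
    ... | inj₁ m∣ = 1ℤ , inj₁ refl , m∣
    ... | inj₂ m∣ = -1ℤ , inj₂ refl , subst (m ℤ.∣_) (negate-step (φ u) (φ v)) (ℤ.∣m⇒∣-m m∣)

    -- A shortest walk never turns back, so all its steps have the sign of the first.
    straight : ∀ {u w v k s} → Sign s → Adj u w → φ w ≈ s ℤ.+ φ u → Walk G w v k →
               (∀ {j} → Walk G u v j → k < j) → φ v ≈ s ℤ.* + suc k ℤ.+ φ u
    straight {u} {w} {s = s} sgn a u→w [] _ = subst (λ t → φ w ≈ t ℤ.+ φ u) (sym (ℤ.*-identityʳ s)) u→w
    straight {u} {w} {v} {suc k} {s} sgn a u→w (_∷_ {v = w′} b p) shortest
      with signed-step b
    ... | t , sgn′ , w→w′ with sign-cases sgn sgn′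
    ...   | inj₁ refl = ∣-combine (straight sgn b w→w′ p (s≤s⁻¹ ∘ shortest ∘ (a ∷_))) u→w
                          (same-direction (φ u) (φ w) (φ v) s (+ suc k))
    -- Opposite steps cancel, so `w′` and `u` have congruent coordinates and coincide. Then `p` is a
    -- walk from `u` to `v` that is too short.
    ...   | inj₂ refl with φ-injective {w′} {u} (∣-combine w→w′ u→w (turn-back (φ u) (φ w) (φ w′) s))
    ...     | refl = contradiction (shortest p) (≤⇒≯ (n≤1+n k))

    Displaced : Fin n → Fin n → ℕ → Set
    Displaced u v k = ∃ λ s → Sign s × φ v ≈ s ℤ.* + k ℤ.+ φ u

    displacement : ∀ u v → Displaced u v (dist u v)
    displacement u v = walk (geodesic u v) dist-≤
      where
      walk : ∀ {u k} → Walk G u v k → (∀ {j} → Walk G u v j → k ≤ j) → Displaced u v k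
      -- The empty walk has no direction; the sign is an arbitrary choice.
      walk {u} [] _ = 1ℤ , inj₁ refl , ℤ.divides 0ℤ (sym (zero-displacement (φ u)))
      walk (a ∷ p) shortest with signed-step a
      ... | s , sgn , u→w = s , sgn , straight sgn a u→w p shortest

    -- Equal signs would give `y` and `z` congruent coordinates. Hence the signs are opposite, and
    -- adding the two congruences cancels the terms in `k`.
    midpoint : ∀ {y z a k} → y ≢ z → Displaced y a k → Displaced z a k → + 2 ℤ.* φ a ≈ φ y ℤ.+ φ z
    midpoint {y} {z} {a} {k} y≢z (s , sgn , y→a) (t , sgn′ , z→a) with sign-cases sgn sgn′
    ... | inj₁ refl = contradiction
            (φ-injective (∣-combine z→a (ℤ.∣m⇒∣-m y→a) (difference (φ y) (φ z) (φ a) (s ℤ.* + k)))) y≢z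
    ... | inj₂ refl = ∣-combine y→a z→a (sum (φ y) (φ z) (φ a) s (+ k))

    equidistant⇒midpoint : ∀ {y z a} → y ≢ z → dist y a ≡ dist z a → + 2 ℤ.* φ a ≈ φ y ℤ.+ φ z
    equidistant⇒midpoint {y} {z} {a} y≢z ya≡za =
      midpoint y≢z (subst (Displaced y a) ya≡za (displacement y a)) (displacement z a)

    -- Twice `φ a` and twice `φ b` are both congruent to `φ y ℤ.+ φ z`; the factor 2 cancels by
    -- `halve`.
    uniquelyEquidistant : UniquelyEquidistant
    uniquelyEquidistant {y} {z} {a} {b} y≢z ya≡za yb≡zb = φ-injective (halve (∣-combine
      (equidistant⇒midpoint y≢z ya≡za) (ℤ.∣m⇒∣-m (equidistant⇒midpoint y≢z yb≡zb))
      (double-difference (φ y) (φ z) (φ a) (φ b))))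

-- Coordinates for paths and odd cycles, and the characterisation.

module _ {n : ℕ} (G : Graph n) (connected : Connected G) where
  open Distance G connected

  path⇒uniquelyEquidistant : G ≅ path n → UniquelyEquidistant
  path⇒uniquelyEquidistant iso = Coordinates.uniquelyEquidistant G connected 0ℤ (+_ ∘ toℕ ∘ to)
    (to-injective ∘ toℕ-injective ∘ ℤ.+-injective ∘ ℤ.i-j≡0⇒i≡j _ _ ∘ ℤ.0∣⇒≡0)
    (Sum.map step step ∘ to-adj)
    halve
    where
    open Iso iso

    step : ∀ {i j} → j ≡ suc i → 0ℤ ℤ.∣ + j ℤ.- (1ℤ ℤ.+ + i)
    step {i} refl = ℤ.divides 0ℤ (ℤ.i≡j⇒i-j≡0 {+ suc i} refl)

    halve : ∀ {x} → 0ℤ ℤ.∣ + 2 ℤ.* x → 0ℤ ℤ.∣ x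
    halve 0∣2x with ℤ.i*j≡0⇒i≡0∨j≡0 (+ 2) (ℤ.0∣⇒≡0 0∣2x)
    ... | inj₂ refl = ℤ.∣-refl

  odd-cycle⇒uniquelyEquidistant : IsOddCycle G → UniquelyEquidistant
  odd-cycle⇒uniquelyEquidistant (2∤n , 3≤n , iso) =
    Coordinates.uniquelyEquidistant G connected (+ n) (+_ ∘ toℕ ∘ to)
      (λ {u} {v} → to-injective ∘ toℕ-injective ∘ ≈⇒≡ (toℕ<n (to u)) (toℕ<n (to v)))
      (Sum.map step step ∘ to-adj)
      halve
    where
    open Iso iso

    -- The absolute difference is at most `i ⊔ j`, hence below `n`, and `n` divides no positive
    -- number below itself.
    ≈⇒≡ : ∀ {i j} → i < n → j < n → + n ℤ.∣ + i ℤ.- + j → i ≡ j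
    ≈⇒≡ {i} {j} i<n j<n n∣ with ℤ.∣ + i ℤ.- + j ∣ in eq | ℤ.∣⇒∣ᵤ n∣
    ... | zero  | _   = ℤ.+-injective (ℤ.i-j≡0⇒i≡j _ _ (ℤ.∣i∣≡0⇒i≡0 eq))
    ... | suc d | n∣′ = contradiction n∣′ (>⇒∤ (≤-<-trans (≤-reflexive (sym eq))
            (≤-<-trans (subst (λ x → ℤ.∣ x ∣ ≤ i ⊔ j) (sym (ℤ.m-n≡m⊖n i j)) (ℤ.∣m⊝n∣≤m⊔n i j))
              (⊔-pres-<m i<n j<n))))

    step : ∀ {i j} → CyclicNext n i j → + n ℤ.∣ + j ℤ.- (1ℤ ℤ.+ + i)
    step {i} (inj₁ refl)          = ℤ.divides 0ℤ (ℤ.i≡j⇒i-j≡0 {+ suc i} refl)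
    -- On the wrap-around edge the difference `0 - (1 + i)` is `- n`.
    step     (inj₂ (refl , refl)) = ℤ.∣m⇒∣-m ℤ.∣-refl

    coprime : Coprime n 2
    coprime {zero}              (_ , 0∣2)   = contradiction (0∣⇒≡0 0∣2) λ ()
    coprime {suc zero}          _           = refl
    coprime {suc (suc zero)}    (2∣n , _)   = contradiction 2∣n 2∤n
    coprime {suc (suc (suc d))} (_ , d∣2)   = contradiction (∣⇒≤ d∣2) λ { (s≤s (s≤s ())) }

    halve : ∀ {x} → + n ℤ.∣ + 2 ℤ.* x → + n ℤ.∣ x
    halve {x} n∣2x = ℤ.∣ᵤ⇒∣ (coprime-divisor coprime (subst (n ∣_) (ℤ.abs-* (+ 2) x) (ℤ.∣⇒∣ᵤ n∣2x)))

-- The vertices 0, 1, 2 are consecutive in paths and cycles alike, with 1 in the middle.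
cherry : ∀ {n} (G : Graph n) (connected : Connected G) (H : Graph n) → G ≅ H → 3 ≤ n →
         (∀ {i j} → toℕ j ≡ suc (toℕ i) → Graph.Adj H i j) → Distance.Cherry G connected
cherry G _ H iso (s≤s (s≤s (s≤s _))) next⇒adj =
  from (suc zero) , from zero , from (suc (suc zero)) ,
  from-adj (next⇒adj refl) , Graph.adj-sym G (from-adj (next⇒adj refl)) ,
  (λ ()) ∘ from-injective
  where open Iso iso

theorem6 : ∀ (n : ℕ) (G : Graph n) (connected : Connected G) →
    res-wt G connected ≡ 3 ⇔ (IsOddCycle G ⊎ (IsPath G × 3 ≤ n))
theorem6 n G connected = mk⇔
  (λ res≡3 → let unique , 3≤n = res-wt≡3⇒ res≡3 in
    uniquelyEquidistant⇒odd-cycle-or-path G connected unique 3≤n)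
  [ (λ odd@(_ , 3≤n , iso) → res-wt≡3⇐ (odd-cycle⇒uniquelyEquidistant G connected odd)
      (cherry G connected (cycle n 3≤n) iso 3≤n (inj₁ ∘ inj₁)))
  , (λ (iso , 3≤n) → res-wt≡3⇐ (path⇒uniquelyEquidistant G connected iso)
      (cherry G connected (path n) iso 3≤n inj₁))
  ]′
  where open Distance G connected
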